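{- The characterization property of Kuroda's translation does not hold in general in higher-order logic: there are a choice of the set of constants, a non-logical constant $P$ of type $o\to o$ and a formula $A$ such that $\vdash_c A_{Ku}\Leftrightarrow A$ but $(P\,A)^{Ku}\Leftrightarrow P\,A$ is not derivable in classical logic, i.e. $\not\vdash_c (P\,A)^{Ku}\Leftrightarrow P\,A$.
   Context: Syntax. Simple types are generated by: $\iota$ (individuals), $o$ (propositions), and $\tau \to \sigma$ for types $\tau,\sigma$. For each type $\tau$ there are a set $\mathcal{V}_\tau$ of variables (infinitely many, as usual) and a set $\mathcal{C}_\tau$ of constants; variables and constants are disjoint. Terms are simply typed: variables and constants of type $\tau$ are terms of type $\tau$; if $x\in\mathcal{V}_\tau$ and $t$ has type $\sigma$, then $\lambda x.t$ has type $\tau\to\sigma$; if $t$ has type $\tau\to\sigma$ and $u$ has type $\tau$, then $t\,u$ has type $\sigma$. Terms are taken up to renaming of bound variables; $t[x\leftarrow u]$ is capture-avoiding substitution; $\equiv_\beta$ is the congruence generated by $(\lambda x.t)u \hookrightarrow t[x\leftarrow u]$ (no $\eta$). Formulas are terms of type $o$. The constants include the logical constants $\top,\bot$ of type $o$; $\neg$ of type $o\to o$; $\Rightarrow,\wedge,\vee$ of type $o\to o\to o$; and for every type $\tau$, $\forall_\tau,\exists_\tau$ of type $(\tau\to o)\to o$, and also $=_\tau$ of type $\tau\to\tau\to o$ (written infix); there may be further constants. $\forall x.A$ and $\exists x.A$ abbreviate $\forall_\tau(\lambda x.A)$, $\exists_\tau(\lambda x.A)$; $A\Leftrightarrow B :=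 (A\Rightarrow B)\wedge(B\Rightarrow A)$. $FV$ denotes free variables. A context is a finite sequence of formulas. Derivability. Intuitionistic logic has the usual natural deduction rules: introduction and elimination for $\Rightarrow,\wedge,\vee$; Not-I: from $\Gamma,A\vdash\bot$ infer $\Gamma\vdash\neg A$; Not-E: from $\Gamma\vdash\neg A$ and $\Gamma\vdash A$ infer $\Gamma\vdash\bot$; Bot-E: from $\Gamma\vdash\bot$ infer $\Gamma\vdash A$; Top-I: $\Gamma\vdash\top$; All-I: from $\Gamma\vdash P\,x$ with $x\notin FV(\Gamma,P)$ infer $\Gamma\vdash\forall P$; All-E: from $\Gamma\vdash\forall P$ infer $\Gamma\vdash P\,t$; Ex-I: from $\Gamma\vdash P\,t$ infer $\Gamma\vdash\exists P$; Ex-E: from $\Gamma\vdash\exists P$ and $\Gamma,P\,x\vdash A$ with $x\notin FV(\Gamma,P,A)$ infer $\Gamma\vdash A$; Ax: $\Gamma,A,\Delta\vdash A$; Conv: from $\Gamma\vdash A$ and $A\equiv_\beta B$ infer $\Gamma\vdash B$. Classical logic adds PEM: $\Gamma\vdash A\vee\neg A$. $\Gamma\vdash_c A$ denotes classical derivability (no rules for equality, no extensionality). Kuroda's translation. For a term $t$, $t_{Ku}$ is defined by: $x_{Ku}:=x$ for variables; $(\forall_\tau)_{Ku}:=\lambda p.\forall_\tau(\lambda x.\neg\neg(p\,x))$ for each type $\tau$; $c_{Ku}:=c$ for every other constant; $(\lambda x.t)_{Ku}:=\lambda x.t_{Ku}$; $(t\,u)_{Ku}:=t_{Ku}\,u_{Ku}$.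 For a formula $A$, $A^{Ku}:=\neg\neg A_{Ku}$. The characterization property is the statement that $\vdash_c A^{Ku}\Leftrightarrow A$ for every formula $A$. -}

module Defs where

open import Data.List using (List; []; _∷_; _++_; concatMap)
open import Data.List.Membership.Propositional using (_∈_; _∉_)
open import Data.List.Relation.Unary.Any using (here; there)
open import Data.Nat using (ℕ)
open import Data.Product using (_×_; _,_)
open import Relation.Binary.PropositionalEquality using (refl)

infixr 20 _⇒_

data Ty : Set where
  ι o : Ty
  _⇒_ : Ty → Ty → Ty

-- The non-logical constants of each type; the logical ones are always present.
Signature : Set₁
Signature = Ty → Set

data Const (S : Signature) : Ty → Set where
  ⊤ᶜ ⊥ᶜ    : Const S o
  ¬ᶜ       : Const S (o ⇒ o)
  ⇒ᶜ ∧ᶜ ∨ᶜ : Const S (o ⇒ o ⇒ o)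
  ∀ᶜ ∃ᶜ    : (τ : Ty) → Const S ((τ ⇒ o) ⇒ o)
  =ᶜ       : (τ : Ty) → Const S (τ ⇒ τ ⇒ o)
  nonlog   : ∀ {τ} → S τ → Const S τ

-- Terms up to renaming of bound variables: bound variables are de Bruijn
-- indices into Δ, free variables are names, with a countably infinite supply
-- at every type.  In particular every type is inhabited by a term, even when
-- it has no constants.  Terms proper are those with Δ = [].
data Tm (S : Signature) (Δ : List Ty) : Ty → Set where
  bvar : ∀ {τ} → τ ∈ Δ → Tm S Δ τ
  fvar : ∀ {τ} → ℕ → Tm S Δ τ
  con  : ∀ {τ} → Const S τ → Tm S Δ τ
  lam  : ∀ {τ σ} → Tm S (τ ∷ Δ) σ → Tm S Δ (τ ⇒ σ)
  app  : ∀ {τ σ} → Tm S Δ (τ ⇒ σ) → Tm S Δ τ → Tm S Δ σ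

Term : Signature → Ty → Set
Term S τ = Tm S [] τ

Formula : Signature → Set
Formula S = Term S o

private
  variable
    S    : Signature
    Δ Δ′ : List Ty
    τ σ  : Ty

-- A variable is determined by its type together with its name.
FV : Tm S Δ τ → List (Ty × ℕ)
FV (bvar i)         = []
FV (fvar {τ = τ} x) = (τ , x) ∷ []
FV (con c)          = []
FV (lam t)          = FV t
FV (app t u)        = FV t ++ FV u

Ren : List Ty → List Ty → Set
Ren Δ Δ′ = ∀ {τ} → τ ∈ Δ → τ ∈ Δ′

liftRen : Ren Δ Δ′ → Ren (σ ∷ Δ) (σ ∷ Δ′)
liftRen ρ (here eq) = here eq
liftRen ρ (there i) = there (ρ i)

rename : Ren Δ Δ′ → Tm S Δ τ → Tm S Δ′ τ
rename ρ (bvar i)  = bvar (ρ i)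
rename ρ (fvar x)  = fvar x
rename ρ (con c)   = con c
rename ρ (lam t)   = lam (rename (liftRen ρ) t)
rename ρ (app t u) = app (rename ρ t) (rename ρ u)

Sub : Signature → List Ty → List Ty → Set
Sub S Δ Δ′ = ∀ {τ} → τ ∈ Δ → Tm S Δ′ τ

liftSub : Sub S Δ Δ′ → Sub S (σ ∷ Δ) (σ ∷ Δ′)
liftSub θ (here eq) = bvar (here eq)
liftSub θ (there i) = rename there (θ i)

subst : Sub S Δ Δ′ → Tm S Δ τ → Tm S Δ′ τ
subst θ (bvar i)  = θ i
subst θ (fvar x)  = fvar x
subst θ (con c)   = con c
subst θ (lam t)   = lam (subst (liftSub θ) t)
subst θ (app t u) = app (subst θ t) (subst θ u)

single : Tm S Δ σ → Sub S (σ ∷ Δ) Δ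
single u (here refl) = u
single u (there i)   = bvar i

_[_] : Tm S (σ ∷ Δ) τ → Tm S Δ σ → Tm S Δ τ
t [ u ] = subst (single u) t

infix 4 _≡β_

data _≡β_ {S : Signature} {Δ : List Ty} : ∀ {τ} → Tm S Δ τ → Tm S Δ τ → Set where
  β        : (t : Tm S (σ ∷ Δ) τ) (u : Tm S Δ σ) → app (lam t) u ≡β t [ u ]
  ≡β-refl  : {t : Tm S Δ τ} → t ≡β t
  ≡β-sym   : {t u : Tm S Δ τ} → t ≡β u → u ≡β t
  ≡β-trans : {t u v : Tm S Δ τ} → t ≡β u → u ≡β v → t ≡β v
  ≡β-lam   : {t t′ : Tm S (σ ∷ Δ) τ} → t ≡β t′ → lam t ≡β lam t′
  ≡β-app   : {t t′ : Tm S Δ (σ ⇒ τ)} {u u′ : Tm S Δ σ} →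
             t ≡β t′ → u ≡β u′ → app t u ≡β app t′ u′

infix  16 ¬̇_
infixr 15 _∧̇_
infixr 14 _∨̇_
infixr 13 _⇒̇_
infix  12 _⇔̇_

⊤̇ ⊥̇ : Tm S Δ o
⊤̇ = con ⊤ᶜ
⊥̇ = con ⊥ᶜ

¬̇_ : Tm S Δ o → Tm S Δ o
¬̇ A = app (con ¬ᶜ) A

_⇒̇_ _∧̇_ _∨̇_ _⇔̇_ : Tm S Δ o → Tm S Δ o → Tm S Δ o
A ⇒̇ B = app (app (con ⇒ᶜ) A) B
A ∧̇ B = app (app (con ∧ᶜ) A) B
A ∨̇ B = app (app (con ∨ᶜ) A) B
A ⇔̇ B = (A ⇒̇ B) ∧̇ (B ⇒̇ A)

-- Applied to a predicate, not to a formula with a bound variable.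
∀̇ ∃̇ : Tm S Δ (τ ⇒ o) → Tm S Δ o
∀̇ P = app (con (∀ᶜ _)) P
∃̇ P = app (con (∃ᶜ _)) P

-- Written with the most recent hypothesis first.
Ctx : Signature → Set
Ctx S = List (Formula S)

FVᶜ : Ctx S → List (Ty × ℕ)
FVᶜ = concatMap FV

infix 4 _⊢c_

data _⊢c_ {S : Signature} (Γ : Ctx S) : Formula S → Set where
  ax    : ∀ {A} → A ∈ Γ → Γ ⊢c A
  conv  : ∀ {A B} → Γ ⊢c A → A ≡β B → Γ ⊢c B
  ⊤-I   : Γ ⊢c ⊤̇
  ⊥-E   : ∀ {A} → Γ ⊢c ⊥̇ → Γ ⊢c A
  ¬-I   : ∀ {A} → A ∷ Γ ⊢c ⊥̇ → Γ ⊢c ¬̇ A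
  ¬-E   : ∀ {A} → Γ ⊢c ¬̇ A → Γ ⊢c A → Γ ⊢c ⊥̇
  ⇒-I   : ∀ {A B} → A ∷ Γ ⊢c B → Γ ⊢c A ⇒̇ B
  ⇒-E   : ∀ {A B} → Γ ⊢c A ⇒̇ B → Γ ⊢c A → Γ ⊢c B
  ∧-I   : ∀ {A B} → Γ ⊢c A → Γ ⊢c B → Γ ⊢c A ∧̇ B
  ∧-E₁  : ∀ {A B} → Γ ⊢c A ∧̇ B → Γ ⊢c A
  ∧-E₂  : ∀ {A B} → Γ ⊢c A ∧̇ B → Γ ⊢c B
  ∨-I₁  : ∀ {A B} → Γ ⊢c A → Γ ⊢c A ∨̇ B
  ∨-I₂  : ∀ {A B} → Γ ⊢c B → Γ ⊢c A ∨̇ B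
  ∨-E   : ∀ {A B C} → Γ ⊢c A ∨̇ B → A ∷ Γ ⊢c C → B ∷ Γ ⊢c C → Γ ⊢c C
  ∀-I   : ∀ {τ} {P : Term S (τ ⇒ o)} (x : ℕ) → (τ , x) ∉ FVᶜ Γ ++ FV P →
          Γ ⊢c app P (fvar x) → Γ ⊢c ∀̇ P
  ∀-E   : ∀ {τ} {P : Term S (τ ⇒ o)} (t : Term S τ) → Γ ⊢c ∀̇ P → Γ ⊢c app P t
  ∃-I   : ∀ {τ} {P : Term S (τ ⇒ o)} (t : Term S τ) → Γ ⊢c app P t → Γ ⊢c ∃̇ P
  ∃-E   : ∀ {τ} {P : Term S (τ ⇒ o)} {A} (x : ℕ) →
          (τ , x) ∉ FVᶜ Γ ++ FV P ++ FV A →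
          Γ ⊢c ∃̇ P → app P (fvar x) ∷ Γ ⊢c A → Γ ⊢c A
  pem   : ∀ {A} → Γ ⊢c A ∨̇ ¬̇ A

-- The clause for ∀ is λ p. ∀ (λ x. ¬ ¬ (p x)).
Kuᶜ : Const S τ → Tm S Δ τ
Kuᶜ (∀ᶜ τ) = lam (∀̇ (lam (¬̇ ¬̇ app (bvar (there (here refl))) (bvar (here refl)))))
Kuᶜ c      = con c

infix 21 _₍Ku₎ _⁽Ku⁾

_₍Ku₎ : Tm S Δ τ → Tm S Δ τ
bvar i  ₍Ku₎ = bvar i
fvar x  ₍Ku₎ = fvar x
con c   ₍Ku₎ = Kuᶜ c
lam t   ₍Ku₎ = lam (t ₍Ku₎)
app t u ₍Ku₎ = app (t ₍Ku₎) (u ₍Ku₎)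

_⁽Ku⁾ : Formula S → Formula S
A ⁽Ku⁾ = ¬̇ ¬̇ (A ₍Ku₎)

CharacterizationProperty : Signature → Set
CharacterizationProperty S = (A : Formula S) → [] ⊢c A ⁽Ku⁾ ⇔̇ A

{-# OPTIONS --safe #-}
-- Classical derivability has no extensionality, so a model may have several
-- true propositions.  Take three truth values, ⊥ < ⊤⁻ < ⊤⁺, both ⊤⁻ and ⊤⁺
-- counting as true, and let ¬ return only ⊥ or ⊤⁻, so that ¬¬⊤⁺ = ⊤⁻.  Over a
-- one-element domain, A = ∀x.⊤ denotes ⊤⁺ while A_Ku, β-equal to ∀x.¬¬⊤,
-- denotes ⊤⁻; a predicate P true of ⊤⁺ only makes P A true and (P A)^Ku false.
-- All types are finite in this model, so quantification is decidable and
-- soundness of excluded middle needs no classical metatheory.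
module Submission where

open import Defs
open import Data.Fin using (Fin; zero; suc; combine; finToFun; funToFin)
open import Data.Fin.Properties using (finToFun-funToFin)
  renaming (_≟_ to _≟ᶠ_)
open import Data.List using (List; []; _∷_; _++_)
open import Data.List.Membership.Propositional using (_∈_; _∉_)
open import Data.List.Membership.Propositional.Properties using (∈-++⁺ˡ; ∈-++⁺ʳ)
open import Data.List.Relation.Unary.All using (All; []; _∷_)
  renaming (lookup to lookupAll)
open import Data.List.Relation.Unary.Any using (here; there)
open import Data.Nat using (ℕ; zero; suc; _^_)
import Data.Nat.Properties as ℕ
open import Data.Product using (Σ; _×_; _,_)
open import Data.Product.Properties using (≡-dec)
open import Data.Sum using (_⊎_; inj₁; inj₂)
open import Data.Vec.Functional using (foldr)
open import Function using (_∘_)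
open import Relation.Binary.Definitions using (DecidableEquality)
open import Relation.Binary.PropositionalEquality
  using (_≡_; _≢_; _≗_; refl; sym; trans; cong; cong₂)
  renaming (subst to transport)
open import Relation.Nullary using (¬_; yes; no; contradiction)
open import Relation.Nullary.Decidable using (map′; _×-dec_)

private
  variable
    S     : Signature
    Δ Δ′  : List Ty
    Γ     : Ctx S
    ρ σ τ : Ty

-- Decidable equality of types and variables.

infix 4 _≟ᵗ_ _≟ᵛ_

_≟ᵗ_ : DecidableEquality Ty
ι        ≟ᵗ ι         = yes refl
ι        ≟ᵗ o         = no λ ()
ι        ≟ᵗ (_ ⇒ _)   = no λ ()
o        ≟ᵗ ι         = no λ ()
o        ≟ᵗ o         = yes refl
o        ≟ᵗ (_ ⇒ _)   = no λ ()
(_ ⇒ _)  ≟ᵗ ι         = no λ ()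
(_ ⇒ _)  ≟ᵗ o         = no λ ()
(σ ⇒ τ)  ≟ᵗ (σ′ ⇒ τ′) =
  map′ (λ { (refl , refl) → refl }) (λ { refl → refl , refl })
       ((σ ≟ᵗ σ′) ×-dec (τ ≟ᵗ τ′))

_≟ᵛ_ : DecidableEquality (Ty × ℕ)
_≟ᵛ_ = ≡-dec _≟ᵗ_ ℕ._≟_

-- This is what makes `Λ` respect pointwise equality, and hence lets equalities pass under a binder.
funToFin-cong : ∀ {m n} {f g : Fin m → Fin n} → f ≗ g → funToFin f ≡ funToFin g
funToFin-cong {zero}  eq = refl
funToFin-cong {suc m} eq = cong₂ combine (eq zero) (funToFin-cong (eq ∘ suc))

-- The full finite type structure

card : Ty → ℕ
card ι       = 1
card o       = 3
card (σ ⇒ τ) = card τ ^ card σ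

-- Functions are coded by their tables, so that pointwise equal functions are
-- equal without function extensionality.
record D (τ : Ty) : Set where
  constructor ⟨_⟩
  field
    code : Fin (card τ)

open D

infixl 20 _·_

_·_ : D (σ ⇒ τ) → D σ → D τ
f · d = ⟨ finToFun (code f) (code d) ⟩

Λ : (D σ → D τ) → D (σ ⇒ τ)
Λ f = ⟨ funToFin (λ i → code (f ⟨ i ⟩)) ⟩

Λ₂ : (D ρ → D σ → D τ) → D (ρ ⇒ σ ⇒ τ)
Λ₂ f = Λ λ d → Λ (f d)

Λ-cong : {f g : D σ → D τ} → f ≗ g → Λ f ≡ Λ g
Λ-cong eq = cong ⟨_⟩ (funToFin-cong (λ i → cong code (eq ⟨ i ⟩)))

-- The β law of the model: decoding a table inverts its encoding.
Λ-· : (f : D σ → D τ) (d : D σ) → Λ f · d ≡ f d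
Λ-· f d = cong ⟨_⟩ (finToFun-funToFin (λ i → code (f ⟨ i ⟩)) (code d))

Λ₂-· : (f : D ρ → D σ → D τ) (d : D ρ) (e : D σ) → Λ₂ f · d · e ≡ f d e
Λ₂-· f d e = trans (cong (_· e) (Λ-· (λ d → Λ (f d)) d)) (Λ-· (f d) e)

-- Truth values

pattern ⊥ᵛ   = ⟨ zero ⟩
pattern tr i = ⟨ suc i ⟩
pattern ⊤⁻   = tr zero
pattern ⊤⁺   = tr (suc zero)

data True : D o → Set where
  true : ∀ {i} → True (tr i)

¬ᵛ : D o → D o
¬ᵛ ⊥ᵛ     = ⊤⁻
¬ᵛ (tr _) = ⊥ᵛ

-- When both arguments are true, the value is the first one: hence a
-- conjunction over a one-element domain keeps the value of its only conjunct.
_∧ᵛ_ : D o → D o → D o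
p ∧ᵛ ⊥ᵛ   = ⊥ᵛ
p ∧ᵛ tr _ = p

_∨ᵛ_ : D o → D o → D o
⊥ᵛ       ∨ᵛ q = q
p@(tr _) ∨ᵛ q = p

_⇒ᵛ_ : D o → D o → D o
⊥ᵛ   ⇒ᵛ q = ⊤⁺
tr _ ⇒ᵛ q = q

-- Quantifiers are folds over all codes. At `ι`, with its single code, `∀ᵛ f` is `f ⟨ zero ⟩ ∧ᵛ ⊤⁺`,
-- which is `f ⟨ zero ⟩`, so the two true values stay distinct.
∀ᵛ ∃ᵛ : (D τ → D o) → D o
∀ᵛ f = foldr _∧ᵛ_ ⊤⁺ (f ∘ ⟨_⟩)
∃ᵛ f = foldr _∨ᵛ_ ⊥ᵛ (f ∘ ⟨_⟩)

_=ᵛ_ : D τ → D τ → D o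
d =ᵛ e with code d ≟ᶠ code e
... | yes _ = ⊤⁺
... | no  _ = ⊥ᵛ

True? : (p : D o) → True p ⊎ True (¬ᵛ p)
True? ⊥ᵛ     = inj₂ true
True? (tr _) = inj₁ true

¬ᵛ-intro : ∀ p → ¬ True p → True (¬ᵛ p)
¬ᵛ-intro ⊥ᵛ     _  = true
¬ᵛ-intro (tr _) ¬p = contradiction true ¬p

¬ᵛ-elim : ∀ {p} → True (¬ᵛ p) → ¬ True p
¬ᵛ-elim () true

∧ᵛ-intro : ∀ {p q} → True p → True q → True (p ∧ᵛ q)
∧ᵛ-intro true true = true

∧ᵛ-elim : ∀ p q → True (p ∧ᵛ q) → True p × True q
∧ᵛ-elim (tr _) (tr _) _ = true , true

∨ᵛ-intro₁ : ∀ {p} q → True p → True (p ∨ᵛ q)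
∨ᵛ-intro₁ q true = true

∨ᵛ-intro₂ : ∀ p {q} → True q → True (p ∨ᵛ q)
∨ᵛ-intro₂ ⊥ᵛ     t = t
∨ᵛ-intro₂ (tr _) _ = true

∨ᵛ-elim : ∀ p q → True (p ∨ᵛ q) → True p ⊎ True q
∨ᵛ-elim ⊥ᵛ     q t = inj₂ t
∨ᵛ-elim (tr _) q _ = inj₁ true

⇒ᵛ-intro : ∀ p q → (True p → True q) → True (p ⇒ᵛ q)
⇒ᵛ-intro ⊥ᵛ     q _ = true
⇒ᵛ-intro (tr _) q f = f true

⇒ᵛ-elim : ∀ {p q} → True (p ⇒ᵛ q) → True p → True q
⇒ᵛ-elim t true = t

-- Finite conjunctions and disjunctions.

foldr-∧ᵛ-intro : ∀ {n} (g : Fin n → D o) → (∀ i → True (g i)) →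
                 True (foldr _∧ᵛ_ ⊤⁺ g)
foldr-∧ᵛ-intro {zero}  g t = true
foldr-∧ᵛ-intro {suc n} g t = ∧ᵛ-intro (t zero) (foldr-∧ᵛ-intro (g ∘ suc) (t ∘ suc))

foldr-∧ᵛ-elim : ∀ {n} (g : Fin n → D o) → True (foldr _∧ᵛ_ ⊤⁺ g) →
                ∀ i → True (g i)
foldr-∧ᵛ-elim {suc n} g t i with ∧ᵛ-elim (g zero) _ t
foldr-∧ᵛ-elim {suc n} g t zero    | t₀ , _  = t₀
foldr-∧ᵛ-elim {suc n} g t (suc i) | _  , ts = foldr-∧ᵛ-elim (g ∘ suc) ts i

foldr-∨ᵛ-intro : ∀ {n} (g : Fin n → D o) i → True (g i) →
                 True (foldr _∨ᵛ_ ⊥ᵛ g)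
foldr-∨ᵛ-intro g zero    t = ∨ᵛ-intro₁ _ t
foldr-∨ᵛ-intro g (suc i) t = ∨ᵛ-intro₂ (g zero) (foldr-∨ᵛ-intro (g ∘ suc) i t)

foldr-∨ᵛ-elim : ∀ {n} (g : Fin n → D o) → True (foldr _∨ᵛ_ ⊥ᵛ g) →
                Σ (Fin n) λ i → True (g i)
foldr-∨ᵛ-elim {suc n} g t with ∨ᵛ-elim (g zero) _ t
... | inj₁ t₀ = zero , t₀
... | inj₂ ts with foldr-∨ᵛ-elim (g ∘ suc) ts
...   | i , tᵢ = suc i , tᵢ

-- Interpretation of terms

Valuation : Set
Valuation = ∀ τ → ℕ → D τ

-- Supplies the valuation at which the counterexample is evaluated.
default : (τ : Ty) → D τ
default ι       = ⟨ zero ⟩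
default o       = ⊥ᵛ
default (σ ⇒ τ) = Λ λ _ → default τ

Env : List Ty → Set
Env Δ = ∀ {τ} → τ ∈ Δ → D τ

ε : Env []
ε ()

_▸_ : Env Δ → D σ → Env (σ ∷ Δ)
(e ▸ d) (here refl) = d
(e ▸ d) (there i)   = e i

update : Valuation → (τ : Ty) → ℕ → D τ → Valuation
update φ τ x d σ y with (τ , x) ≟ᵛ (σ , y)
... | yes refl = d
... | no  _    = φ σ y

update-same : (φ : Valuation) (x : ℕ) (d : D τ) → update φ τ x d τ x ≡ d
update-same {τ} φ x d with (τ , x) ≟ᵛ (τ , x)
... | yes refl = refl
... | no  ≢    = contradiction refl ≢

update-other : (φ : Valuation) (x y : ℕ) (d : D τ) → (τ , x) ≢ (σ , y) →
               update φ τ x d σ y ≡ φ σ y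
update-other {τ} {σ} φ x y d ≢ with (τ , x) ≟ᵛ (σ , y)
... | yes eq = contradiction eq ≢
... | no  _  = refl

module Semantics {S : Signature} (I : ∀ {τ} → S τ → D τ) where

  ⟦_⟧ᶜ : Const S τ → D τ
  ⟦ ⊤ᶜ ⟧ᶜ       = ⊤⁺
  ⟦ ⊥ᶜ ⟧ᶜ       = ⊥ᵛ
  ⟦ ¬ᶜ ⟧ᶜ       = Λ ¬ᵛ
  ⟦ ⇒ᶜ ⟧ᶜ       = Λ₂ _⇒ᵛ_
  ⟦ ∧ᶜ ⟧ᶜ       = Λ₂ _∧ᵛ_
  ⟦ ∨ᶜ ⟧ᶜ       = Λ₂ _∨ᵛ_
  ⟦ ∀ᶜ τ ⟧ᶜ     = Λ λ f → ∀ᵛ (f ·_)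
  ⟦ ∃ᶜ τ ⟧ᶜ     = Λ λ f → ∃ᵛ (f ·_)
  ⟦ =ᶜ τ ⟧ᶜ     = Λ₂ _=ᵛ_
  ⟦ nonlog c ⟧ᶜ = I c

  ⟦_⟧ : Tm S Δ τ → Valuation → Env Δ → D τ
  ⟦ bvar i ⟧  φ e = e i
  ⟦ fvar {τ} x ⟧ φ e = φ τ x
  ⟦ con c ⟧   φ e = ⟦ c ⟧ᶜ
  ⟦ lam t ⟧   φ e = Λ λ d → ⟦ t ⟧ φ (e ▸ d)
  ⟦ app t u ⟧ φ e = ⟦ t ⟧ φ e · ⟦ u ⟧ φ e

  -- Renaming, substitution and conversion in the model.

  ⟦rename⟧ : (φ : Valuation) (r : Ren Δ Δ′) {e : Env Δ} {e′ : Env Δ′} →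
             (∀ {τ} (i : τ ∈ Δ) → e′ (r i) ≡ e i) →
             (t : Tm S Δ τ) → ⟦ rename r t ⟧ φ e′ ≡ ⟦ t ⟧ φ e
  ⟦rename⟧ φ r eq (bvar i)  = eq i
  ⟦rename⟧ φ r eq (fvar x)  = refl
  ⟦rename⟧ φ r eq (con c)   = refl
  ⟦rename⟧ φ r eq (lam t)   = Λ-cong λ d →
    ⟦rename⟧ φ (liftRen r) (λ { (here refl) → refl ; (there i) → eq i }) t
  ⟦rename⟧ φ r eq (app t u) = cong₂ _·_ (⟦rename⟧ φ r eq t) (⟦rename⟧ φ r eq u)

  -- Environments are functions, so they are related index by index, as for renaming, which avoids
  -- function extensionality. Under a binder the substituted terms are weakened, and `⟦rename⟧`
  -- shows that their values do not change.
  ⟦subst⟧ : (φ : Valuation) (θ : Sub S Δ Δ′) {e : Env Δ} {e′ : Env Δ′} →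
            (∀ {τ} (i : τ ∈ Δ) → ⟦ θ i ⟧ φ e′ ≡ e i) →
            (t : Tm S Δ τ) → ⟦ subst θ t ⟧ φ e′ ≡ ⟦ t ⟧ φ e
  ⟦subst⟧ φ θ eq (bvar i)  = eq i
  ⟦subst⟧ φ θ eq (fvar x)  = refl
  ⟦subst⟧ φ θ eq (con c)   = refl
  ⟦subst⟧ φ θ eq (lam t)   = Λ-cong λ d →
    ⟦subst⟧ φ (liftSub θ)
      (λ { (here refl) → refl
         ; (there i)   → trans (⟦rename⟧ φ there (λ _ → refl) (θ i)) (eq i) }) t
  ⟦subst⟧ φ θ eq (app t u) = cong₂ _·_ (⟦subst⟧ φ θ eq t) (⟦subst⟧ φ θ eq u)

  -- Contraction holds by the β law `Λ-·` and the substitution lemma; conversion under `lam` holds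
  -- because functions with equal values have the same table.
  ⟦≡β⟧ : {t u : Tm S Δ τ} → t ≡β u → ∀ φ (e : Env Δ) → ⟦ t ⟧ φ e ≡ ⟦ u ⟧ φ e
  ⟦≡β⟧ (β t u) φ e = trans
    (Λ-· (λ d → ⟦ t ⟧ φ (e ▸ d)) (⟦ u ⟧ φ e))
    (sym (⟦subst⟧ φ (single u) (λ { (here refl) → refl ; (there i) → refl }) t))
  ⟦≡β⟧ ≡β-refl        φ e = refl
  ⟦≡β⟧ (≡β-sym p)     φ e = sym (⟦≡β⟧ p φ e)
  ⟦≡β⟧ (≡β-trans p q) φ e = trans (⟦≡β⟧ p φ e) (⟦≡β⟧ q φ e)
  ⟦≡β⟧ (≡β-lam p)     φ e = Λ-cong λ d → ⟦≡β⟧ p φ (e ▸ d)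
  ⟦≡β⟧ (≡β-app p q)   φ e = cong₂ _·_ (⟦≡β⟧ p φ e) (⟦≡β⟧ q φ e)

  ⟦update-fresh⟧ : (φ : Valuation) (x : ℕ) (d : D σ) (e : Env Δ) (t : Tm S Δ τ) →
                   (σ , x) ∉ FV t → ⟦ t ⟧ (update φ σ x d) e ≡ ⟦ t ⟧ φ e
  ⟦update-fresh⟧ φ x d e (bvar i)  ∉ = refl
  ⟦update-fresh⟧ φ x d e (fvar y)  ∉ = update-other φ x y d (∉ ∘ here)
  ⟦update-fresh⟧ φ x d e (con c)   ∉ = refl
  ⟦update-fresh⟧ φ x d e (lam t)   ∉ = Λ-cong λ d′ → ⟦update-fresh⟧ φ x d (e ▸ d′) t ∉
  ⟦update-fresh⟧ φ x d e (app t u) ∉ = cong₂ _·_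
    (⟦update-fresh⟧ φ x d e t (∉ ∘ ∈-++⁺ˡ))
    (⟦update-fresh⟧ φ x d e u (∉ ∘ ∈-++⁺ʳ (FV t)))

  -- Truth conditions and soundness.

  infix 4 _⊨_ _⊨ᶜ_

  _⊨_ : Valuation → Formula S → Set
  φ ⊨ A = True (⟦ A ⟧ φ ε)

  _⊨ᶜ_ : Valuation → Ctx S → Set
  φ ⊨ᶜ Γ = All (φ ⊨_) Γ

  ⊨ᶜ-update-fresh : (φ : Valuation) (x : ℕ) (d : D σ) (Γ : Ctx S) →
                    (σ , x) ∉ FVᶜ Γ → φ ⊨ᶜ Γ → update φ σ x d ⊨ᶜ Γ
  ⊨ᶜ-update-fresh φ x d []      ∉ []      = []
  ⊨ᶜ-update-fresh φ x d (A ∷ Γ) ∉ (t ∷ γ) =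
    transport True (sym (⟦update-fresh⟧ φ x d ε A (∉ ∘ ∈-++⁺ˡ))) t
    ∷ ⊨ᶜ-update-fresh φ x d Γ (∉ ∘ ∈-++⁺ʳ (FV A)) γ

  -- Lets an eigenvariable denote an arbitrary element, as `∀-I` and `∃-E` require.
  ⟦app-fresh⟧ : (φ : Valuation) (x : ℕ) (d : D σ) (P : Term S (σ ⇒ τ)) →
                (σ , x) ∉ FV P →
                ⟦ app P (fvar x) ⟧ (update φ σ x d) ε ≡ ⟦ P ⟧ φ ε · d
  ⟦app-fresh⟧ φ x d P ∉ = cong₂ _·_ (⟦update-fresh⟧ φ x d ε P ∉) (update-same φ x d)

  module _ (φ : Valuation) where

    ⊨¬⁺ : ∀ A → True (¬ᵛ (⟦ A ⟧ φ ε)) → φ ⊨ ¬̇ A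
    ⊨¬⁺ A = transport True (sym (Λ-· ¬ᵛ (⟦ A ⟧ φ ε)))

    ⊨¬⁻ : ∀ A → φ ⊨ ¬̇ A → True (¬ᵛ (⟦ A ⟧ φ ε))
    ⊨¬⁻ A = transport True (Λ-· ¬ᵛ (⟦ A ⟧ φ ε))

    ⊨⇒⁺ : ∀ A B → True (⟦ A ⟧ φ ε ⇒ᵛ ⟦ B ⟧ φ ε) → φ ⊨ A ⇒̇ B
    ⊨⇒⁺ A B = transport True (sym (Λ₂-· _⇒ᵛ_ (⟦ A ⟧ φ ε) (⟦ B ⟧ φ ε)))

    ⊨⇒⁻ : ∀ A B → φ ⊨ A ⇒̇ B → True (⟦ A ⟧ φ ε ⇒ᵛ ⟦ B ⟧ φ ε)
    ⊨⇒⁻ A B = transport True (Λ₂-· _⇒ᵛ_ (⟦ A ⟧ φ ε) (⟦ B ⟧ φ ε))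

    ⊨∧⁺ : ∀ A B → True (⟦ A ⟧ φ ε ∧ᵛ ⟦ B ⟧ φ ε) → φ ⊨ A ∧̇ B
    ⊨∧⁺ A B = transport True (sym (Λ₂-· _∧ᵛ_ (⟦ A ⟧ φ ε) (⟦ B ⟧ φ ε)))

    ⊨∧⁻ : ∀ A B → φ ⊨ A ∧̇ B → φ ⊨ A × φ ⊨ B
    ⊨∧⁻ A B = ∧ᵛ-elim _ _ ∘ transport True (Λ₂-· _∧ᵛ_ (⟦ A ⟧ φ ε) (⟦ B ⟧ φ ε))

    ⊨∨⁺ : ∀ A B → True (⟦ A ⟧ φ ε ∨ᵛ ⟦ B ⟧ φ ε) → φ ⊨ A ∨̇ B
    ⊨∨⁺ A B = transport True (sym (Λ₂-· _∨ᵛ_ (⟦ A ⟧ φ ε) (⟦ B ⟧ φ ε)))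

    ⊨∨⁻ : ∀ A B → φ ⊨ A ∨̇ B → φ ⊨ A ⊎ φ ⊨ B
    ⊨∨⁻ A B = ∨ᵛ-elim _ _ ∘ transport True (Λ₂-· _∨ᵛ_ (⟦ A ⟧ φ ε) (⟦ B ⟧ φ ε))

    ⊨∀⁺ : (P : Term S (τ ⇒ o)) → (∀ d → True (⟦ P ⟧ φ ε · d)) → φ ⊨ ∀̇ P
    ⊨∀⁺ P t = transport True (sym (Λ-· (λ f → ∀ᵛ (f ·_)) (⟦ P ⟧ φ ε)))
      (foldr-∧ᵛ-intro _ (λ i → t ⟨ i ⟩))

    ⊨∀⁻ : (P : Term S (τ ⇒ o)) → φ ⊨ ∀̇ P → ∀ d → True (⟦ P ⟧ φ ε · d)
    -- By the eta rule for `D`, `⟨ code d ⟩` is `d`, so the instances at codes cover every element.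
    ⊨∀⁻ P t d = foldr-∧ᵛ-elim _
      (transport True (Λ-· (λ f → ∀ᵛ (f ·_)) (⟦ P ⟧ φ ε)) t) (code d)

    ⊨∃⁺ : (P : Term S (τ ⇒ o)) (d : D τ) → True (⟦ P ⟧ φ ε · d) → φ ⊨ ∃̇ P
    ⊨∃⁺ P d t = transport True (sym (Λ-· (λ f → ∃ᵛ (f ·_)) (⟦ P ⟧ φ ε)))
      (foldr-∨ᵛ-intro _ (code d) t)

    ⊨∃⁻ : (P : Term S (τ ⇒ o)) → φ ⊨ ∃̇ P → Σ (D τ) λ d → True (⟦ P ⟧ φ ε · d)
    ⊨∃⁻ P t
      with foldr-∨ᵛ-elim _ (transport True (Λ-· (λ f → ∃ᵛ (f ·_)) (⟦ P ⟧ φ ε)) t)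
    ... | i , tᵢ = ⟨ i ⟩ , tᵢ

  -- Induction on the derivation. The valuation is quantified after the derivation because `∀-I` and
  -- `∃-E` apply the induction hypothesis at an updated one.
  sound : ∀ {Γ A} → Γ ⊢c A → (φ : Valuation) → φ ⊨ᶜ Γ → φ ⊨ A
  sound (ax A∈Γ) φ γ = lookupAll γ A∈Γ
  sound (conv p A≡B) φ γ = transport True (⟦≡β⟧ A≡B φ ε) (sound p φ γ)
  sound ⊤-I φ γ = true
  sound (⊥-E p) φ γ with () ← sound p φ γ
  sound (¬-I {A} p) φ γ = ⊨¬⁺ φ A (¬ᵛ-intro _ λ t →
    contradiction (sound p φ (t ∷ γ)) λ ())
  sound (¬-E {A} p q) φ γ =
    contradiction (sound q φ γ) (¬ᵛ-elim (⊨¬⁻ φ A (sound p φ γ)))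
  sound (⇒-I {A} {B} p) φ γ =
    ⊨⇒⁺ φ A B (⇒ᵛ-intro _ _ λ t → sound p φ (t ∷ γ))
  sound (⇒-E {A} {B} p q) φ γ = ⇒ᵛ-elim (⊨⇒⁻ φ A B (sound p φ γ)) (sound q φ γ)
  sound (∧-I {A} {B} p q) φ γ = ⊨∧⁺ φ A B (∧ᵛ-intro (sound p φ γ) (sound q φ γ))
  sound (∧-E₁ {A} {B} p) φ γ with t , _ ← ⊨∧⁻ φ A B (sound p φ γ) = t
  sound (∧-E₂ {A} {B} p) φ γ with _ , t ← ⊨∧⁻ φ A B (sound p φ γ) = t
  sound (∨-I₁ {A} {B} p) φ γ = ⊨∨⁺ φ A B (∨ᵛ-intro₁ _ (sound p φ γ))
  sound (∨-I₂ {A} {B} p) φ γ = ⊨∨⁺ φ A B (∨ᵛ-intro₂ _ (sound p φ γ))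
  sound (∨-E {A} {B} p q r) φ γ with ⊨∨⁻ φ A B (sound p φ γ)
  ... | inj₁ t = sound q φ (t ∷ γ)
  ... | inj₂ t = sound r φ (t ∷ γ)
  sound {Γ} (∀-I {P = P} x x∉ p) φ γ = ⊨∀⁺ φ P λ d →
    transport True (⟦app-fresh⟧ φ x d P (x∉ ∘ ∈-++⁺ʳ (FVᶜ Γ)))
      (sound p (update φ _ x d) (⊨ᶜ-update-fresh φ x d Γ (x∉ ∘ ∈-++⁺ˡ) γ))
  sound (∀-E {P = P} t p) φ γ = ⊨∀⁻ φ P (sound p φ γ) (⟦ t ⟧ φ ε)
  sound (∃-I {P = P} t p) φ γ = ⊨∃⁺ φ P (⟦ t ⟧ φ ε) (sound p φ γ)
  sound {Γ} (∃-E {P = P} {A} x x∉ p q) φ γ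
    with d , t ← ⊨∃⁻ φ P (sound p φ γ) =
    transport True
      (⟦update-fresh⟧ φ x d ε A (x∉ ∘ ∈-++⁺ʳ (FVᶜ Γ) ∘ ∈-++⁺ʳ (FV P)))
      (sound q (update φ _ x d)
        (transport True
           (sym (⟦app-fresh⟧ φ x d P (x∉ ∘ ∈-++⁺ʳ (FVᶜ Γ) ∘ ∈-++⁺ˡ))) t
         ∷ ⊨ᶜ-update-fresh φ x d Γ (x∉ ∘ ∈-++⁺ˡ) γ))
  sound (pem {A}) φ γ with True? (⟦ A ⟧ φ ε)
  ... | inj₁ t = ⊨∨⁺ φ A (¬̇ A) (∨ᵛ-intro₁ _ t)
  ... | inj₂ t = ⊨∨⁺ φ A (¬̇ A) (∨ᵛ-intro₂ (⟦ A ⟧ φ ε) (⊨¬⁺ φ A t))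

-- The counterexample

∀⊤ : Formula S
∀⊤ = ∀̇ {τ = ι} (lam ⊤̇)

-- The trailing [] is FV of the quantified predicate, as in ∀-I.
⊢∀⊤ : (ι , 0) ∉ FVᶜ Γ ++ [] → Γ ⊢c ∀⊤
⊢∀⊤ fresh = ∀-I 0 fresh (conv ⊤-I (≡β-sym (β ⊤̇ (fvar 0))))

⊢∀⊤-Ku : (ι , 0) ∉ FVᶜ Γ ++ [] → Γ ⊢c ∀⊤ ₍Ku₎
⊢∀⊤-Ku {Γ = Γ} fresh =
  -- The outer conversion restores the redex formed by the translated quantifier and its argument;
  -- the inner one applies the contracted predicate to the eigenvariable.
  conv (∀-I 0 fresh (conv ¬¬⊤ (≡β-sym (β _ (fvar 0))))) (≡β-sym (β _ (lam ⊤̇)))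
  where
  ¬¬⊤ : Γ ⊢c ¬̇ ¬̇ app (lam ⊤̇) (fvar 0)
  ¬¬⊤ = ¬-I (¬-E (ax (here refl)) (conv ⊤-I (≡β-sym (β ⊤̇ (fvar 0)))))

-- Both sides are theorems. The hypothesis added by `⇒-I` is closed, so freshness holds by
-- computation.
⊢∀⊤-Ku⇔∀⊤ : ([] {A = Formula S}) ⊢c ∀⊤ ₍Ku₎ ⇔̇ ∀⊤
⊢∀⊤-Ku⇔∀⊤ = ∧-I (⇒-I (⊢∀⊤ λ ())) (⇒-I (⊢∀⊤-Ku λ ()))

data Predicate : Signature where
  P : Predicate (o ⇒ o)

-- Separates the two true values, so that `P` does not respect provable equivalence: it holds of the
-- value `⊤⁺` of `∀⊤` and fails of the value `⊤⁻` of its translation.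
is-⊤⁺ : D o → D o
is-⊤⁺ ⊤⁺ = ⊤⁺
is-⊤⁺ _  = ⊥ᵛ

⟦P⟧ : Predicate τ → D τ
⟦P⟧ P = Λ is-⊤⁺

P∀⊤ : Formula Predicate
P∀⊤ = app (con (nonlog P)) ∀⊤

⊬P∀⊤⁽Ku⁾⇔P∀⊤ : ¬ ([] ⊢c P∀⊤ ⁽Ku⁾ ⇔̇ P∀⊤)
-- The biconditional is closed and evaluates to ⊥ᵛ by computation.
⊬P∀⊤⁽Ku⁾⇔P∀⊤ p = contradiction (sound p (λ τ _ → default τ) []) λ ()
  where open Semantics ⟦P⟧

mainTheorem6 : Σ Signature λ S →
    ¬ CharacterizationProperty S
    × (Σ (S (o ⇒ o)) λ P → Σ (Formula S) λ A →
    ([] ⊢c A ₍Ku₎ ⇔̇ A)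
    × ¬ ([] ⊢c (app (con (nonlog P)) A) ⁽Ku⁾ ⇔̇ app (con (nonlog P)) A))
mainTheorem6 =
  Predicate , (λ char → ⊬P∀⊤⁽Ku⁾⇔P∀⊤ (char P∀⊤)) ,
  P , ∀⊤ , ⊢∀⊤-Ku⇔∀⊤ , ⊬P∀⊤⁽Ku⁾⇔P∀⊤
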